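{- Let $\mathcal{A}$ be a downset in $\mathcal{B}(n)$, and let $\mathcal{I}$ be the set of the first $|\mathcal{A}|$ elements of the level-colex order on $\mathcal{B}(n)$. Then $w(\mathcal{A}) \le w(\mathcal{I})$.
   Context: $\mathcal{B}(n)$ is the Boolean lattice of all subsets of $[n]=\{1,\dots,n\}$ ordered by inclusion. A downset is a family $\mathcal{D}$ such that $X \in \mathcal{D}$ and $Y \subseteq X$ imply $Y \in \mathcal{D}$. The width $w(\mathcal{X})$ of a family $\mathcal{X}$ is the maximum size of an antichain (family of pairwise inclusion-incomparable sets) contained in $\mathcal{X}$. The level-colex order on $\mathcal{B}(n)$ is the total order with $A<B$ if either $|A|<|B|$, or $|A|=|B|$ and $\max(A \triangle B) \in B$. -}

module Defs where

open import Data.Nat using (ℕ; _≤_; _<_)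
open import Data.Fin using (Fin) renaming (_<_ to _<ᶠ_)
open import Data.Fin.Subset using (Subset; _⊆_; ∣_∣) renaming (_∈_ to _∈ˢ_; _∉_ to _∉ˢ_)
open import Data.List using (List; length)
open import Data.List.Membership.Propositional using (_∈_)
open import Data.List.Relation.Unary.All using (All)
open import Data.List.Relation.Unary.AllPairs using (AllPairs)
open import Data.List.Relation.Unary.Unique.Propositional using (Unique)
open import Data.Product using (Σ; _×_; ∃)
open import Data.Sum using (_⊎_)
open import Relation.Nullary using (¬_)
open import Relation.Binary.PropositionalEquality using (_≡_)
open import Function.Bundles using (_⇔_)

-- A family of subsets of [n] = {1..n} (element k+1 is the index k : Fin n),
-- represented as a duplicate-free list; its size |F| is the length.
record Family (n : ℕ) : Set where
  constructor family
  field
    members : List (Subset n)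
    distinct : Unique members
open Family public

_∈F_ : ∀ {n} → Subset n → Family n → Set
X ∈F F = X ∈ members F

size : ∀ {n} → Family n → ℕ
size F = length (members F)

IsDownset : ∀ {n} → Family n → Set
IsDownset D = ∀ X Y → X ∈F D → Y ⊆ X → Y ∈F D

Incomparable : ∀ {n} → Subset n → Subset n → Set
Incomparable X Y = ¬ (X ⊆ Y) × ¬ (Y ⊆ X)

record AntichainIn {n} (F : Family n) : Set where
  field
    elems : List (Subset n)
    elemsDistinct : Unique elems
    elemsInF : All (_∈F F) elems
    pairwiseIncomparable : AllPairs Incomparable elems
open AntichainIn public

WidthLE : ∀ {n} → Family n → Family n → Set
WidthLE A B = (L : AntichainIn A) → Σ (AntichainIn B) λ M → length (elems L) ≤ length (elems M)

MaxSymDiffIn : ∀ {n} → Subset n → Subset n → Set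
MaxSymDiffIn {n} A B =
  ∃ λ (i : Fin n) → i ∈ˢ B × i ∉ˢ A × (∀ (j : Fin n) → i <ᶠ j → (j ∈ˢ A ⇔ j ∈ˢ B))

_<colex_ : ∀ {n} → Subset n → Subset n → Set
A <colex B = ∣ A ∣ < ∣ B ∣ ⊎ (∣ A ∣ ≡ ∣ B ∣ × MaxSymDiffIn A B)

IsInitialColex : ∀ {n} → ℕ → Family n → Set
IsInitialColex k I = size I ≡ k × (∀ X Y → X ∈F I → Y <colex X → Y ∈F I)

{-# OPTIONS --safe #-}

-- Let t(X) be the length of the initial run {1,…,t} ⊆ X. In colex order a set X adds exactly t(X)
-- new sets to the shadow, so an initial segment J of level-colex has |J| − Σ_{X ∈ J} t(X) maximal
-- elements. By Kruskal–Katona, a downset with d_k sets of size k has at most Σ_k (d_k − s_k)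
-- maximal elements, s_k being the sum of t over the first d_k sets of level k. Finally, for
-- j ≤ k, moving sets from the end of a segment of level k to the end of a segment of level j
-- until one is full or the other empty does not increase the sum of t; the levels can therefore
-- be filled from the bottom, which ends in an initial segment of level-colex of the same size.
-- The same exchange inequality yields Kruskal–Katona by induction on n.
module Submission where

open import Data.Bool using (true; false)
import Data.Bool.Properties as Bool
open import Data.Fin using (zero; suc)
open import Data.Fin.Subset using (Subset; inside; outside; _⊆_; ∣_∣; ⊤)
open import Data.Fin.Subset.Properties using (_⊆?_; ⊆-refl; ⊆-reflexive; ⊆-trans; p⊆q⇒∣p∣≤∣q∣; drop-∷-⊆; out⊆; s⊆s; ∣p∣≤n)
open import Data.List using (List; []; _∷_; [_]; _++_; length; map; filter; take; concatMap)
import Data.List.Membership.DecPropositional as DecMembership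
open import Data.List.Membership.Propositional using (_∈_; find)
open import Data.List.Membership.Propositional.Properties using (∈-map⁺; ∈-++⁺ˡ; ∈-++⁺ʳ; ∈-++⁻; ∈-∃++; ∈-filter⁺; ∈-filter⁻; ∈-concatMap⁺; ∈-AllPairs₂)
open import Data.List.Properties using (length-++; length-map; length-filter; length-take; ++-assoc; map-++; map-∘; map-cong-local; filter-++; take-map; take-all; take-[])
open import Data.List.Relation.Unary.All as All using (All; []; _∷_)
import Data.List.Relation.Unary.All.Properties as All
open import Data.List.Relation.Unary.AllPairs as AllPairs using (AllPairs; []; _∷_)
import Data.List.Relation.Unary.AllPairs.Properties as AllPairs
open import Data.List.Relation.Unary.Any as Any using (Any; here; there; any?)
open import Data.List.Relation.Unary.Unique.Propositional using (Unique)
import Data.List.Relation.Unary.Unique.Propositional.Properties as Unique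
open import Data.Nat using (ℕ; zero; suc; _+_; _∸_; _⊔_; _≤_; _<_; z≤n; s≤s; _≤?_; _<?_)
open import Data.Nat.ListAction using (sum)
open import Data.Nat.ListAction.Properties using (sum-++)
open import Data.Nat.Properties
open import Data.Nat.Tactic.RingSolver using (solve-∀)
open import Data.Product using (∃; _×_; _,_; proj₁; proj₂)
open import Data.Sum using (_⊎_; inj₁; inj₂)
open import Data.Vec using ([]; _∷_; _∷ʳ_; initLast; here; there)
open import Data.Vec.Properties using (≡-dec)
open import Function using (_∘_; mk⇔; Equivalence)
open import Level using (0ℓ)
open import Relation.Binary.Definitions using (DecidableEquality)
open import Relation.Binary.PropositionalEquality using (_≡_; _≢_; refl; sym; trans; cong; cong₂; subst; subst₂)
open import Relation.Nullary using (¬_; yes; no; contradiction; ¬?; does)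
open import Relation.Nullary.Decidable using (_×-dec_)
open import Relation.Unary using (Pred; Decidable)

open import Defs

-- Pouring weighted sequences

prefixSum : List ℕ → ℕ → ℕ
prefixSum U a = sum (take a U)

prefixSum-mono : ∀ U {a b} → a ≤ b → prefixSum U a ≤ prefixSum U b
prefixSum-mono U       z≤n       = z≤n
prefixSum-mono []      (s≤s a≤b) = z≤n
prefixSum-mono (u ∷ U) (s≤s a≤b) = +-monoʳ-≤ u (prefixSum-mono U a≤b)

prefixSum-short : ∀ U V {a} → a ≤ length U → prefixSum (U ++ V) a ≡ prefixSum U a
prefixSum-short []      V z≤n       = refl
prefixSum-short (u ∷ U) V z≤n       = refl
prefixSum-short (u ∷ U) V (s≤s a≤U) = cong (u +_) (prefixSum-short U V a≤U)

prefixSum-long : ∀ U V a → prefixSum (U ++ V) (length U + a) ≡ sum U + prefixSum V a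
prefixSum-long []      V a = refl
prefixSum-long (u ∷ U) V a = trans (cong (u +_) (prefixSum-long U V a)) (sym (+-assoc u _ _))

prefixSum-length : ∀ U → prefixSum U (length U) ≡ sum U
prefixSum-length U = cong sum (take-all (length U) U ≤-refl)

prefixSum≤sum : ∀ U a → prefixSum U a ≤ sum U
prefixSum≤sum U       zero    = z≤n
prefixSum≤sum []      (suc a) = z≤n
prefixSum≤sum (u ∷ U) (suc a) = +-monoʳ-≤ u (prefixSum≤sum U a)

splitAt : ∀ m a → a ≤ m ⊎ ∃ λ c → a ≡ m + c
splitAt m a with a ≤? m
... | yes a≤m = inj₁ a≤m
... | no  a≰m = inj₂ (a ∸ m , sym (m+[n∸m]≡n (≰⇒≥ a≰m)))

excess≤ : ∀ {m a b c} → a ≤ m → a + b ≡ m + c → c ≤ b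
excess≤ {m} {a} {b} {c} a≤m eq = +-cancelˡ-≤ m c b (≤-trans (≤-reflexive (sym eq)) (+-monoˡ-≤ b a≤m))

remainder≤ : ∀ (U V : List ℕ) {c} → length U + c ≤ length (U ++ V) → c ≤ length V
remainder≤ U V {c} p = +-cancelˡ-≤ (length U) c _ (≤-trans p (≤-reflexive (length-++ U)))

within-++ : ∀ (U V : List ℕ) {a b} → a ≤ length U → b ≤ length V → a + b ≤ length (U ++ V)
within-++ U V p q = ≤-trans (+-mono-≤ p q) (≤-reflexive (sym (length-++ U)))

infix 4 _▷_

-- Pouring a prefix of V into the free places of U does not increase the total weight.
_▷_ : List ℕ → List ℕ → Set
U ▷ V = ∀ a b → a ≤ length U → b ≤ length V →
  prefixSum (U ++ V) (a + b) ≤ prefixSum U a + prefixSum V b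

-- If `a` exceeds `length U`, the block `U` cancels. Otherwise a total within `U` never reaches
-- `U′`, and past the end of `U` the entries of `U′ ++ V` weigh no more than those of `V` alone, by
-- `U′ ▷ V` with nothing taken from `U′`; `U ▷ V` finishes.
▷-++ˡ : ∀ U U′ V → U ▷ V → U′ ▷ V → (U ++ U′) ▷ V
▷-++ˡ U U′ V U▷V U′▷V a b a≤ b≤ rewrite ++-assoc U U′ V with splitAt (length U) a
... | inj₂ (c , refl) rewrite +-assoc (length U) c b
        | prefixSum-long U (U′ ++ V) (c + b) | prefixSum-long U U′ c
        | +-assoc (sum U) (prefixSum U′ c) (prefixSum V b) =
  +-monoʳ-≤ (sum U) (U′▷V c b (remainder≤ U U′ a≤) b≤)
... | inj₁ a≤U rewrite prefixSum-short U U′ a≤U with splitAt (length U) (a + b)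
...   | inj₁ a+b≤U = begin
  prefixSum (U ++ (U′ ++ V)) (a + b) ≡⟨ prefixSum-short U (U′ ++ V) a+b≤U ⟩
  prefixSum U (a + b)                ≡⟨ sym (prefixSum-short U V a+b≤U) ⟩
  prefixSum (U ++ V) (a + b)         ≤⟨ U▷V a b a≤U b≤ ⟩
  prefixSum U a + prefixSum V b      ∎
  where open ≤-Reasoning
...   | inj₂ (c , eq) = begin
  prefixSum (U ++ (U′ ++ V)) (a + b)        ≡⟨ cong (prefixSum (U ++ (U′ ++ V))) eq ⟩
  prefixSum (U ++ (U′ ++ V)) (length U + c) ≡⟨ prefixSum-long U (U′ ++ V) c ⟩
  sum U + prefixSum (U′ ++ V) c
    ≤⟨ +-monoʳ-≤ (sum U) (U′▷V 0 c z≤n (≤-trans (excess≤ a≤U eq) b≤)) ⟩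
  sum U + prefixSum V c                     ≡⟨ sym (prefixSum-long U V c) ⟩
  prefixSum (U ++ V) (length U + c)         ≡⟨ cong (prefixSum (U ++ V)) (sym eq) ⟩
  prefixSum (U ++ V) (a + b)                ≤⟨ U▷V a b a≤U b≤ ⟩
  prefixSum U a + prefixSum V b             ∎
  where open ≤-Reasoning

x+[y+z]≡[x+z]+y : ∀ x y z → x + (y + z) ≡ (x + z) + y
x+[y+z]≡[x+z]+y = solve-∀

x+[y+z]≡y+[x+z] : ∀ x y z → x + (y + z) ≡ y + (x + z)
x+[y+z]≡y+[x+z] = solve-∀

-- When `b` exceeds `length V`, the part taken from `V′` is poured into `U` first. If it fits, all
-- of `V` is poured after it; if it overflows, `U` is full and `V` adds `sum V` wherever it stands.
▷-++ʳ : ∀ U V V′ → U ▷ V → U ▷ V′ → U ▷ (V ++ V′)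
▷-++ʳ U V V′ U▷V U▷V′ a b a≤ b≤ with splitAt (length V) b
... | inj₁ b≤V rewrite sym (++-assoc U V V′)
        | prefixSum-short (U ++ V) V′ (within-++ U V a≤ b≤V) | prefixSum-short V V′ b≤V =
  U▷V a b a≤ b≤V
... | inj₂ (c , refl) with splitAt (length U) (a + c)
...   | inj₁ a+c≤U = begin
  prefixSum (U ++ (V ++ V′)) (a + (length V + c))
    ≡⟨ cong₂ prefixSum (sym (++-assoc U V V′)) (x+[y+z]≡[x+z]+y a (length V) c) ⟩
  prefixSum ((U ++ V) ++ V′) (a + c + length V)
    ≡⟨ prefixSum-short (U ++ V) V′ (within-++ U V a+c≤U ≤-refl) ⟩
  prefixSum (U ++ V) (a + c + length V)
    ≤⟨ U▷V (a + c) (length V) a+c≤U ≤-refl ⟩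
  prefixSum U (a + c) + prefixSum V (length V)
    ≡⟨ cong₂ _+_ (sym (prefixSum-short U V′ a+c≤U)) (prefixSum-length V) ⟩
  prefixSum (U ++ V′) (a + c) + sum V
    ≤⟨ +-monoˡ-≤ (sum V) (U▷V′ a c a≤ (remainder≤ V V′ b≤)) ⟩
  prefixSum U a + prefixSum V′ c + sum V
    ≡⟨ sym (x+[y+z]≡[x+z]+y (prefixSum U a) (sum V) (prefixSum V′ c)) ⟩
  prefixSum U a + (sum V + prefixSum V′ c)
    ≡⟨ cong (prefixSum U a +_) (sym (prefixSum-long V V′ c)) ⟩
  prefixSum U a + prefixSum (V ++ V′) (length V + c) ∎
  where open ≤-Reasoning
...   | inj₂ (d , eq) = begin
  prefixSum (U ++ (V ++ V′)) (a + (length V + c))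
    ≡⟨ cong (prefixSum (U ++ (V ++ V′))) (trans (x+[y+z]≡y+[x+z] a (length V) c)
         (trans (cong (length V +_) eq) (x+[y+z]≡y+[x+z] (length V) (length U) d))) ⟩
  prefixSum (U ++ (V ++ V′)) (length U + (length V + d))
    ≡⟨ trans (prefixSum-long U (V ++ V′) (length V + d)) (cong (sum U +_) (prefixSum-long V V′ d)) ⟩
  sum U + (sum V + prefixSum V′ d)
    ≡⟨ x+[y+z]≡y+[x+z] (sum U) (sum V) _ ⟩
  sum V + (sum U + prefixSum V′ d)
    ≡⟨ cong (sum V +_) (sym (prefixSum-long U V′ d)) ⟩
  sum V + prefixSum (U ++ V′) (length U + d)
    ≡⟨ cong (λ z → sum V + prefixSum (U ++ V′) z) (sym eq) ⟩
  sum V + prefixSum (U ++ V′) (a + c)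
    ≤⟨ +-monoʳ-≤ (sum V) (U▷V′ a c a≤ (remainder≤ V V′ b≤)) ⟩
  sum V + (prefixSum U a + prefixSum V′ c)
    ≡⟨ x+[y+z]≡y+[x+z] (sum V) (prefixSum U a) _ ⟩
  prefixSum U a + (sum V + prefixSum V′ c)
    ≡⟨ cong (prefixSum U a +_) (sym (prefixSum-long V V′ c)) ⟩
  prefixSum U a + prefixSum (V ++ V′) (length V + c) ∎
  where open ≤-Reasoning

-- U ▷ U′ can be dispensed with because a and b may be swapped.
▷-++-self : ∀ U U′ → U ▷ U → U′ ▷ U′ → U′ ▷ U → (U ++ U′) ▷ (U ++ U′)
▷-++-self U U′ U▷U U′▷U′ U′▷U a b a≤ b≤ = by-cases (splitAt (length U) a) (splitAt (length U) b)
  where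
  open ≤-Reasoning
  X = U ++ U′

  long : ∀ c b → length U + c ≤ length X → b ≤ length X →
    prefixSum (X ++ X) (length U + c + b) ≤ prefixSum X (length U + c) + prefixSum X b
  long c b a≤ b≤ = begin
    prefixSum (X ++ X) (length U + c + b)
      ≡⟨ cong₂ prefixSum (++-assoc U U′ X) (+-assoc (length U) c b) ⟩
    prefixSum (U ++ (U′ ++ X)) (length U + (c + b))
      ≡⟨ prefixSum-long U (U′ ++ X) (c + b) ⟩
    sum U + prefixSum (U′ ++ X) (c + b)
      ≤⟨ +-monoʳ-≤ (sum U) (▷-++ʳ U′ U U′ U′▷U U′▷U′ c b (remainder≤ U U′ a≤) b≤) ⟩
    sum U + (prefixSum U′ c + prefixSum X b)
      ≡⟨ sym (+-assoc (sum U) _ _) ⟩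
    sum U + prefixSum U′ c + prefixSum X b
      ≡⟨ cong (_+ prefixSum X b) (sym (prefixSum-long U U′ c)) ⟩
    prefixSum X (length U + c) + prefixSum X b ∎

  by-cases : a ≤ length U ⊎ (∃ λ c → a ≡ length U + c) → b ≤ length U ⊎ (∃ λ c → b ≡ length U + c) →
    prefixSum (X ++ X) (a + b) ≤ prefixSum X a + prefixSum X b
  by-cases (inj₂ (c , refl)) _ = long c b a≤ b≤
  by-cases (inj₁ _) (inj₂ (c , refl))
    rewrite +-comm a (length U + c) | +-comm (prefixSum X a) (prefixSum X (length U + c)) =
    long c a b≤ a≤
  -- Here the second copy of `X` matters only through its block `U`, and `X ▷ U` follows from
  -- `U ▷ U` and `U′ ▷ U`.
  by-cases (inj₁ _) (inj₁ b≤U) = begin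
    prefixSum (X ++ X) (a + b)        ≡⟨ cong (λ z → prefixSum z (a + b)) (sym (++-assoc X U U′)) ⟩
    prefixSum ((X ++ U) ++ U′) (a + b) ≡⟨ prefixSum-short (X ++ U) U′ (within-++ X U a≤ b≤U) ⟩
    prefixSum (X ++ U) (a + b)        ≤⟨ ▷-++ˡ U U′ U U▷U U′▷U a b a≤ b≤U ⟩
    prefixSum X a + prefixSum U b     ≡⟨ cong (prefixSum X a +_) (sym (prefixSum-short U U′ b≤U)) ⟩
    prefixSum X a + prefixSum X b     ∎

-- Run lengths of one level and the exchange inequality

0▷ : ∀ V → [ 0 ] ▷ V
0▷ V zero          b _ _ = prefixSum-mono (0 ∷ V) (n≤1+n b)
0▷ V (suc zero)    b _ _ = ≤-refl
0▷ V (suc (suc a)) b (s≤s ()) _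

-- leadingOnes k l lists, in colex order, the lengths of the initial runs {1,…,t} ⊆ X
-- of the k-element subsets X of [k + l].
leadingOnes : ℕ → ℕ → List ℕ
leadingOnes zero    l       = [ 0 ]
leadingOnes (suc k) zero    = [ suc k ]
leadingOnes (suc k) (suc l) = leadingOnes (suc k) l ++ leadingOnes k (suc l)

-- The hypotheses bound every entry by `m`, phrased through increments of prefix sums so that they
-- make sense past the end of a list as well.
prefixSum-suc-++ : ∀ U V m a → (∀ b → prefixSum U (suc b) ≤ prefixSum U b + m) →
  (∀ b → prefixSum V (suc b) ≤ prefixSum V b + m) →
  prefixSum (U ++ V) (suc a) ≤ prefixSum (U ++ V) a + m
prefixSum-suc-++ []      V m a       p q = q a
prefixSum-suc-++ (u ∷ U) V m zero    p q = p zero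
prefixSum-suc-++ (u ∷ U) V m (suc a) p q = ≤-trans
  (+-monoʳ-≤ u (prefixSum-suc-++ U V m a
    (λ b → +-cancelˡ-≤ u _ _ (≤-trans (p (suc b)) (≤-reflexive (+-assoc u _ m)))) q))
  (≤-reflexive (sym (+-assoc u _ m)))

-- An initial run inside a `k`-element set has length at most `k`. The slack `k ≤ m` lets the block
-- with smaller `k` share the same bound.
leadingOnes-bound : ∀ k l m a → k ≤ m →
  prefixSum (leadingOnes k l) (suc a) ≤ prefixSum (leadingOnes k l) a + m
leadingOnes-bound zero l m a k≤m rewrite take-[] {A = ℕ} a = z≤n
leadingOnes-bound (suc k) zero m zero k≤m = ≤-trans (≤-reflexive (+-identityʳ _)) k≤m
leadingOnes-bound (suc k) zero m (suc a) k≤m rewrite take-[] {A = ℕ} a = m≤m+n _ m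
leadingOnes-bound (suc k) (suc l) m a k≤m =
  prefixSum-suc-++ (leadingOnes (suc k) l) (leadingOnes k (suc l)) m a
    (λ b → leadingOnes-bound (suc k) l m b k≤m) (λ b → leadingOnes-bound k (suc l) m b (<⇒≤ k≤m))

-- Pouring replaces the single entry `m` by the next entry of `U`, which is no larger, or leaves it
-- in place when `U` is full.
▷-[] : ∀ U m → (∀ a → prefixSum U (suc a) ≤ prefixSum U a + m) → U ▷ [ m ]
▷-[] U m p a zero a≤ _ rewrite +-identityʳ a | +-identityʳ (prefixSum U a) =
  ≤-reflexive (prefixSum-short U [ m ] a≤)
▷-[] U m p a (suc zero) a≤ _ rewrite +-comm a 1 = ≤-trans
  (prefixSum-suc-++ U [ m ] m a p single)
  (≤-reflexive (cong₂ _+_ (prefixSum-short U [ m ] a≤) (sym (+-identityʳ m))))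
  where
  single : ∀ b → prefixSum [ m ] (suc b) ≤ prefixSum [ m ] b + m
  single zero    = ≤-reflexive (+-identityʳ m)
  single (suc b) rewrite take-[] {A = ℕ} b = m≤m+n _ m
▷-[] U m p a (suc (suc b)) a≤ (s≤s ())

-- The exchange inequality between levels `j` and `j + d` of the same ground set `[j + l + d]`. Each
-- level splits into the sets omitting and those containing the last point, and the resulting pairs
-- of blocks are handled by induction.
leadingOnes-▷ : ∀ j l d → leadingOnes j (l + d) ▷ leadingOnes (j + d) l
leadingOnes-▷ zero    l    d = 0▷ (leadingOnes d l)
-- The upper level consists of the full set, whose run bounds all others.
leadingOnes-▷ (suc j) zero d =
  ▷-[] (leadingOnes (suc j) d) (suc j + d) (λ a → leadingOnes-bound (suc j) d (suc j + d) a (m≤m+n (suc j) d))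
-- For equal levels, the pair of `U` and `U′` would pour a lower level into a higher one;
-- `▷-++-self` avoids this pair.
leadingOnes-▷ (suc j) (suc l) zero
  rewrite +-identityʳ l | +-identityʳ j =
  ▷-++-self (leadingOnes (suc j) l) (leadingOnes j (suc l))
    (subst₂ _▷_ (cong (leadingOnes (suc j)) (+-identityʳ l)) (cong (λ z → leadingOnes (suc z) l) (+-identityʳ j)) (leadingOnes-▷ (suc j) l zero))
    (subst₂ _▷_ (cong (λ z → leadingOnes j (suc z)) (+-identityʳ l)) (cong (λ z → leadingOnes z (suc l)) (+-identityʳ j)) (leadingOnes-▷ j (suc l) zero))
    (subst₂ _▷_ (cong (leadingOnes j) (+-comm l 1)) (cong (λ z → leadingOnes z l) (+-comm j 1)) (leadingOnes-▷ j l 1))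
leadingOnes-▷ (suc j) (suc l) (suc d) =
  let
    U  = leadingOnes (suc j) (l + suc d)
    U′ = leadingOnes j (suc l + suc d)
    V  = leadingOnes (suc j + suc d) l
    V′ = leadingOnes (j + suc d) (suc l)
    -- The levels of `U` and `V′` differ by `d`, those of `U′` and `V` by `d + 2`.
    U▷V′ = subst₂ _▷_ (cong (leadingOnes (suc j)) (sym (+-suc l d)))
      (cong (λ z → leadingOnes z (suc l)) (sym (+-suc j d))) (leadingOnes-▷ (suc j) (suc l) d)
    U′▷V = subst₂ _▷_ (cong (leadingOnes j) (+-suc l (suc d)))
      (cong (λ z → leadingOnes z l) (+-suc j (suc d))) (leadingOnes-▷ j l (suc (suc d)))
  in ▷-++ˡ U U′ (V ++ V′)
       (▷-++ʳ U V V′ (leadingOnes-▷ (suc j) l (suc d)) U▷V′)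
       (▷-++ʳ U′ V V′ U′▷V (leadingOnes-▷ j (suc l) (suc d)))

-- The Eckhoff-Wegner inequality

-- Double counting: a `k`-subset of `[k + 1 + l]` is not full, so it has exactly one colex-least
-- upper cover, and the weight of a `(k + 1)`-set is the number of `k`-sets for which it is that
-- cover. Formally, both sides obey the Pascal recursion.
sum-leadingOnes : ∀ k l → sum (leadingOnes (suc k) l) ≡ length (leadingOnes k (suc l))
sum-leadingOnes zero    zero    = refl
sum-leadingOnes (suc k) zero    = cong suc (sum-leadingOnes k zero)
sum-leadingOnes zero    (suc l) = trans (sum-++ (leadingOnes 1 l) [ 0 ])
  (trans (+-identityʳ _) (sum-leadingOnes zero l))
sum-leadingOnes (suc k) (suc l) = trans (sum-++ (leadingOnes (suc (suc k)) l) (leadingOnes (suc k) (suc l)))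
  (trans (cong₂ _+_ (sum-leadingOnes (suc k) l) (sum-leadingOnes k (suc l)))
    (sym (length-++ (leadingOnes (suc k) (suc l)))))

-- Eckhoff and Wegner's inequality, the induction step of Kruskal–Katona: f₀ and f₁ count the
-- members of a family that omit and contain the last point.
EckhoffWegner : List ℕ → List ℕ → Set
EckhoffWegner P Q = ∀ f₀ f₁ → f₀ ≤ length P → f₁ ≤ length Q →
  prefixSum (P ++ Q) (f₀ + f₁) ≤ (prefixSum P f₀ ⊔ f₁) + prefixSum Q f₁

-- In the application `P`, `Q`, `R` are the runs of three consecutive levels of one ground set. If
-- `f₀` and `f₁` both pass the first blocks, these are cut off: the maximum then shifts by `sum P`
-- on one side and by `length Q` on the other, which agree.
eckhoffWegner-++ : ∀ P Q R → sum P ≡ length Q → Q ▷ Q →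
  EckhoffWegner P Q → EckhoffWegner Q R → EckhoffWegner (P ++ Q) (Q ++ R)
eckhoffWegner-++ P Q R sumP Q▷Q ewPQ ewQR f₀ f₁ f₀≤ f₁≤ =
  by-cases (splitAt (length P) f₀) (splitAt (length Q) f₁)
  where
  open ≤-Reasoning
  Goal = prefixSum ((P ++ Q) ++ (Q ++ R)) (f₀ + f₁) ≤ (prefixSum (P ++ Q) f₀ ⊔ f₁) + prefixSum (Q ++ R) f₁

  beyond : ∀ x y → x ≤ length Q → y ≤ length R →
    prefixSum ((P ++ Q) ++ (Q ++ R)) ((length P + x) + (length Q + y)) ≤
    (sum P + prefixSum Q x ⊔ (length Q + y)) + prefixSum (Q ++ R) (length Q + y)
  beyond x y x≤ y≤ = begin
    prefixSum ((P ++ Q) ++ (Q ++ R)) ((length P + x) + (length Q + y))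
      ≡⟨ cong (prefixSum ((P ++ Q) ++ (Q ++ R))) (trans (interchange (length P) x (length Q) y)
           (cong (_+ (x + y)) (sym (length-++ P)))) ⟩
    prefixSum ((P ++ Q) ++ (Q ++ R)) (length (P ++ Q) + (x + y))
      ≡⟨ prefixSum-long (P ++ Q) (Q ++ R) (x + y) ⟩
    sum (P ++ Q) + prefixSum (Q ++ R) (x + y)
      ≤⟨ +-mono-≤ (≤-reflexive (sum-++ P Q)) (ewQR x y x≤ y≤) ⟩
    (sum P + sum Q) + ((prefixSum Q x ⊔ y) + prefixSum R y)
      ≡⟨ sym (interchange (sum P) _ (sum Q) _) ⟩
    (sum P + (prefixSum Q x ⊔ y)) + (sum Q + prefixSum R y)
      ≡⟨ cong₂ _+_ (trans (+-distribˡ-⊔ (sum P) (prefixSum Q x) y)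
           (cong (λ z → (sum P + prefixSum Q x) ⊔ (z + y)) sumP)) (sym (prefixSum-long Q R y)) ⟩
    (sum P + prefixSum Q x ⊔ (length Q + y)) + prefixSum (Q ++ R) (length Q + y) ∎
    where
    interchange : ∀ a b c d → (a + b) + (c + d) ≡ (a + c) + (b + d)
    interchange = solve-∀

  by-cases : f₀ ≤ length P ⊎ (∃ λ x → f₀ ≡ length P + x) →
    f₁ ≤ length Q ⊎ (∃ λ y → f₁ ≡ length Q + y) → Goal
  by-cases (inj₁ f₀≤P) (inj₁ f₁≤Q)
    rewrite prefixSum-short (P ++ Q) (Q ++ R) (within-++ P Q f₀≤P f₁≤Q)
          | prefixSum-short P Q f₀≤P | prefixSum-short Q R f₁≤Q = ewPQ f₀ f₁ f₀≤P f₁≤Q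
  -- After `P` is cut off, two copies of `Q` meet, and `Q ▷ Q` merges their prefixes.
  by-cases (inj₂ (x , refl)) (inj₁ f₁≤Q) = begin
    prefixSum ((P ++ Q) ++ (Q ++ R)) (length P + x + f₁)
      ≡⟨ cong₂ prefixSum (trans (++-assoc P Q (Q ++ R)) (cong (P ++_) (sym (++-assoc Q Q R))))
           (+-assoc (length P) x f₁) ⟩
    prefixSum (P ++ ((Q ++ Q) ++ R)) (length P + (x + f₁))
      ≡⟨ prefixSum-long P ((Q ++ Q) ++ R) (x + f₁) ⟩
    sum P + prefixSum ((Q ++ Q) ++ R) (x + f₁)
      ≡⟨ cong (sum P +_) (prefixSum-short (Q ++ Q) R (within-++ Q Q x≤Q f₁≤Q)) ⟩
    sum P + prefixSum (Q ++ Q) (x + f₁)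
      ≤⟨ +-monoʳ-≤ (sum P) (Q▷Q x f₁ x≤Q f₁≤Q) ⟩
    sum P + (prefixSum Q x + prefixSum Q f₁)
      ≡⟨ sym (+-assoc (sum P) _ _) ⟩
    (sum P + prefixSum Q x) + prefixSum Q f₁
      ≡⟨ cong₂ _+_ (sym (prefixSum-long P Q x)) (sym (prefixSum-short Q R f₁≤Q)) ⟩
    prefixSum (P ++ Q) (length P + x) + prefixSum (Q ++ R) f₁
      ≤⟨ +-monoˡ-≤ (prefixSum (Q ++ R) f₁) (m≤m⊔n (prefixSum (P ++ Q) (length P + x)) f₁) ⟩
    (prefixSum (P ++ Q) (length P + x) ⊔ f₁) + prefixSum (Q ++ R) f₁ ∎
    where x≤Q = remainder≤ P Q f₀≤
  by-cases (inj₂ (x , refl)) (inj₂ (y , refl)) rewrite prefixSum-long P Q x =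
    beyond x y (remainder≤ P Q f₀≤) (remainder≤ Q R f₁≤)
  -- Raising `f₀` to `length P` can only increase the left side, while the maximum on the right
  -- stays at most `f₁`, because `sum P` equals `length Q`.
  by-cases (inj₁ f₀≤P) (inj₂ (y , refl)) = begin
    prefixSum ((P ++ Q) ++ (Q ++ R)) (f₀ + (length Q + y))
      ≤⟨ prefixSum-mono ((P ++ Q) ++ (Q ++ R))
           (+-monoˡ-≤ (length Q + y) (≤-trans f₀≤P (m≤m+n (length P) 0))) ⟩
    prefixSum ((P ++ Q) ++ (Q ++ R)) ((length P + 0) + (length Q + y))
      ≤⟨ beyond 0 y z≤n (remainder≤ Q R f₁≤) ⟩
    (sum P + 0 ⊔ (length Q + y)) + prefixSum (Q ++ R) (length Q + y)
      ≤⟨ +-monoˡ-≤ (prefixSum (Q ++ R) (length Q + y)) (⊔-lub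
           (≤-trans (≤-reflexive (trans (+-identityʳ (sum P)) sumP))
             (≤-trans (m≤m+n (length Q) y) (m≤n⊔m _ _)))
           (m≤n⊔m (prefixSum (P ++ Q) f₀) (length Q + y))) ⟩
    (prefixSum (P ++ Q) f₀ ⊔ (length Q + y)) + prefixSum (Q ++ R) (length Q + y) ∎

-- The list is `k, k - 1, …, 0`, so the entry following the first `m` is `k - m`.
leadingOnes-1 : ∀ k m → suc m ≤ length (leadingOnes k 1) →
  suc k + prefixSum (leadingOnes k 1) m ≤ suc m + prefixSum (leadingOnes k 1) (suc m)
leadingOnes-1 zero    zero    _ = ≤-refl
leadingOnes-1 zero    (suc m) (s≤s ())
leadingOnes-1 (suc k) zero    _ = ≤-refl
leadingOnes-1 (suc k) (suc m) (s≤s p) = s≤s (begin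
  suc k + (suc k + prefixSum (leadingOnes k 1) m)
    ≤⟨ +-monoʳ-≤ (suc k) (leadingOnes-1 k m p) ⟩
  suc k + (suc m + prefixSum (leadingOnes k 1) (suc m))
    ≡⟨ x+[y+z]≡y+[x+z] (suc k) (suc m) _ ⟩
  suc m + (suc k + prefixSum (leadingOnes k 1) (suc m)) ∎)
  where open ≤-Reasoning

-- Splitting both lists at their last point once more produces the common block needed by
-- `eckhoffWegner-++`.
eckhoffWegner : ∀ k l → EckhoffWegner (leadingOnes (suc k) l) (leadingOnes k (suc l))
eckhoffWegner zero l f₀ zero f₀≤ _
  rewrite +-identityʳ f₀ | prefixSum-short (leadingOnes 1 l) [ 0 ] f₀≤ =
  ≤-trans (m≤m⊔n _ 0) (m≤m+n _ 0)
-- Among the singletons only the set of the first point has a nonzero run, so the total weight is 1.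
eckhoffWegner zero l f₀ (suc f₁) f₀≤ _ = begin
  prefixSum (leadingOnes 1 (suc l)) (f₀ + suc f₁) ≤⟨ prefixSum≤sum (leadingOnes 1 (suc l)) (f₀ + suc f₁) ⟩
  sum (leadingOnes 1 (suc l))                     ≡⟨ sum-leadingOnes zero (suc l) ⟩
  1                                               ≤⟨ s≤s z≤n ⟩
  suc f₁                                          ≤⟨ m≤n⊔m _ (suc f₁) ⟩
  prefixSum (leadingOnes 1 l) f₀ ⊔ suc f₁         ≤⟨ m≤m+n _ _ ⟩
  (prefixSum (leadingOnes 1 l) f₀ ⊔ suc f₁) + prefixSum [ 0 ] (suc f₁) ∎
  where open ≤-Reasoning
eckhoffWegner (suc k) zero zero zero _ _ = z≤n
-- No set omitting the last point is present, yet the list starts with the run `2 + k` of the one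
-- such set; `leadingOnes-1` compares that run with the last entry taken on the right.
eckhoffWegner (suc k) zero zero (suc m) _ f₁≤ = leadingOnes-1 (suc k) m f₁≤
eckhoffWegner (suc k) zero (suc zero) f₁ _ _ = +-monoˡ-≤ (prefixSum (leadingOnes (suc k) 1) f₁)
  (≤-trans (≤-reflexive (sym (+-identityʳ (2 + k)))) (m≤m⊔n (2 + k + 0) f₁))
eckhoffWegner (suc k) zero (suc (suc f₀)) f₁ (s≤s ()) _
eckhoffWegner (suc k) (suc l) =
  eckhoffWegner-++ (leadingOnes (suc (suc k)) l) (leadingOnes (suc k) (suc l)) (leadingOnes k (suc (suc l)))
    (sum-leadingOnes (suc k) l)
    (subst₂ _▷_ (cong (leadingOnes (suc k)) (+-identityʳ (suc l)))
      (cong (λ z → leadingOnes z (suc l)) (+-identityʳ (suc k))) (leadingOnes-▷ (suc k) (suc l) 0))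
    (eckhoffWegner (suc k) l) (eckhoffWegner k (suc l))

-- Subsets in colex order

length-⊆ : ∀ {A : Set} {xs ys : List A} → Unique xs → (∀ {x} → x ∈ xs → x ∈ ys) → length xs ≤ length ys
length-⊆ {xs = []} _ _ = z≤n
length-⊆ {xs = x ∷ xs} {ys} (x∉xs ∷ uxs) xs⊆ys with ∈-∃++ (xs⊆ys (here refl))
... | ps , qs , refl = begin
  suc (length xs)               ≤⟨ s≤s (length-⊆ uxs xs⊆ps++qs) ⟩
  suc (length (ps ++ qs))       ≡⟨ cong suc (length-++ ps) ⟩
  suc (length ps + length qs)   ≡⟨ sym (+-suc (length ps) (length qs)) ⟩
  length ps + length (x ∷ qs)   ≡⟨ sym (length-++ ps) ⟩
  length (ps ++ x ∷ qs)         ∎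
  where
  open ≤-Reasoning
  xs⊆ps++qs : ∀ {y} → y ∈ xs → y ∈ ps ++ qs
  xs⊆ps++qs y∈xs with ∈-++⁻ ps (xs⊆ys (there y∈xs))
  ... | inj₁ y∈ps           = ∈-++⁺ˡ y∈ps
  ... | inj₂ (here refl)    = contradiction refl (All.lookup x∉xs y∈xs)
  ... | inj₂ (there y∈qs)   = ∈-++⁺ʳ ps y∈qs

module _ {A : Set} {P Q : Pred A 0ℓ} (P? : Decidable P) (Q? : Decidable Q) where

  length-filter-mono : (∀ {x} → P x → Q x) → ∀ xs → length (filter P? xs) ≤ length (filter Q? xs)
  length-filter-mono P⇒Q [] = z≤n
  length-filter-mono P⇒Q (x ∷ xs) with P? x | Q? x
  ... | yes _ | yes _ = s≤s (length-filter-mono P⇒Q xs)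
  ... | yes p | no ¬q = contradiction (P⇒Q p) ¬q
  ... | no _  | yes _ = m≤n⇒m≤1+n (length-filter-mono P⇒Q xs)
  ... | no _  | no _  = length-filter-mono P⇒Q xs

module _ {A : Set} {P : Pred A 0ℓ} (P? : Decidable P) where

  length-filter-++ : ∀ xs ys → length (filter P? (xs ++ ys)) ≡ length (filter P? xs) + length (filter P? ys)
  length-filter-++ xs ys = trans (cong length (filter-++ P? xs ys)) (length-++ (filter P? xs))

  length-filter-map : ∀ {B : Set} (f : B → A) xs → length (filter P? (map f xs)) ≡ length (filter (P? ∘ f) xs)
  length-filter-map f [] = refl
  length-filter-map f (x ∷ xs) with does (P? (f x))
  ... | true  = cong suc (length-filter-map f xs)
  ... | false = length-filter-map f xs

  length-filter-∁ : ∀ xs → length xs ≡ length (filter (¬? ∘ P?) xs) + length (filter P? xs)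
  length-filter-∁ [] = refl
  length-filter-∁ (x ∷ xs) with does (P? x)
  ... | false = cong suc (length-filter-∁ xs)
  ... | true  = trans (cong suc (length-filter-∁ xs)) (sym (+-suc _ _))

private variable n : ℕ

_≟ˢ_ : DecidableEquality (Subset n)
_≟ˢ_ = ≡-dec Bool._≟_

∣∷ʳ-outside∣ : (X : Subset n) → ∣ X ∷ʳ outside ∣ ≡ ∣ X ∣
∣∷ʳ-outside∣ []            = refl
∣∷ʳ-outside∣ (inside ∷ X)  = cong suc (∣∷ʳ-outside∣ X)
∣∷ʳ-outside∣ (outside ∷ X) = ∣∷ʳ-outside∣ X

∣∷ʳ-inside∣ : (X : Subset n) → ∣ X ∷ʳ inside ∣ ≡ suc ∣ X ∣
∣∷ʳ-inside∣ []            = refl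
∣∷ʳ-inside∣ (inside ∷ X)  = cong suc (∣∷ʳ-inside∣ X)
∣∷ʳ-inside∣ (outside ∷ X) = ∣∷ʳ-inside∣ X

∷ʳ-⊆ : ∀ s {X Y : Subset n} → X ⊆ Y → X ∷ʳ s ⊆ Y ∷ʳ s
∷ʳ-⊆ s {[]}          {[]}    _   = ⊆-refl
∷ʳ-⊆ s {outside ∷ X} {y ∷ Y} X⊆Y = out⊆ (∷ʳ-⊆ s (drop-∷-⊆ X⊆Y))
∷ʳ-⊆ s {inside ∷ X}  {y ∷ Y} X⊆Y with X⊆Y here
... | here = s⊆s (∷ʳ-⊆ s (drop-∷-⊆ X⊆Y))

∷ʳ-out⊆in : (X : Subset n) → X ∷ʳ outside ⊆ X ∷ʳ inside
∷ʳ-out⊆in []      = out⊆ ⊆-refl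
∷ʳ-out⊆in (x ∷ X) = s⊆s (∷ʳ-out⊆in X)

infix 4 _≺_ _<ˡᶜ_

-- Colex as an inductive relation: `here` marks the largest point of difference, with equal tails
-- beyond it, and `there` passes over smaller points, where the sets may differ freely.
data _≺_ : Subset n → Subset n → Set where
  here  : {X : Subset n} → outside ∷ X ≺ inside ∷ X
  there : ∀ {s t} {X Y : Subset n} → X ≺ Y → s ∷ X ≺ t ∷ Y

≺-irrefl : {X : Subset n} → ¬ X ≺ X
≺-irrefl (there X≺X) = ≺-irrefl X≺X

≺-asym : {X Y : Subset n} → X ≺ Y → ¬ Y ≺ X
≺-asym here        (there X≺X) = ≺-irrefl X≺X
≺-asym (there X≺X) here        = ≺-irrefl X≺X
≺-asym (there X≺Y) (there Y≺X) = ≺-asym X≺Y Y≺X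

≺-∷ʳ : ∀ s {X Y : Subset n} → X ≺ Y → X ∷ʳ s ≺ Y ∷ʳ s
≺-∷ʳ s here        = here
≺-∷ʳ s (there X≺Y) = there (≺-∷ʳ s X≺Y)

∷ʳ-out≺in : (X Y : Subset n) → X ∷ʳ outside ≺ Y ∷ʳ inside
∷ʳ-out≺in []      []      = here
∷ʳ-out≺in (x ∷ X) (y ∷ Y) = there (∷ʳ-out≺in X Y)

≺⇒MaxSymDiffIn : {X Y : Subset n} → X ≺ Y → MaxSymDiffIn X Y
≺⇒MaxSymDiffIn here = zero , here , (λ ()) ,
  λ { (suc j) _ → mk⇔ (λ { (there j∈X) → there j∈X }) (λ { (there j∈X) → there j∈X }) }
≺⇒MaxSymDiffIn (there X≺Y) with ≺⇒MaxSymDiffIn X≺Y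
... | i , i∈Y , i∉X , agree = suc i , there i∈Y , (λ { (there i∈X) → i∉X i∈X }) ,
  λ { (suc j) (s≤s i<j) → let open Equivalence (agree j i<j) in
      mk⇔ (λ { (there j∈X) → there (to j∈X) }) (λ { (there j∈Y) → there (from j∈Y) }) }

⊆∧≢⇒≺ : {X Y : Subset n} → X ⊆ Y → X ≢ Y → X ≺ Y
⊆∧≢⇒≺ {X = []} {[]} _ X≢Y = contradiction refl X≢Y
⊆∧≢⇒≺ {X = x ∷ X} {y ∷ Y} X⊆Y X≢Y with X ≟ˢ Y
... | no X≢Y′ = there (⊆∧≢⇒≺ (drop-∷-⊆ X⊆Y) X≢Y′)
⊆∧≢⇒≺ {X = outside ∷ X} {outside ∷ X} X⊆Y X≢Y | yes refl = contradiction refl X≢Y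
⊆∧≢⇒≺ {X = outside ∷ X} {inside ∷ X}  X⊆Y X≢Y | yes refl = here
⊆∧≢⇒≺ {X = inside ∷ X}  {y ∷ X}       X⊆Y X≢Y | yes refl with X⊆Y here
... | here = contradiction refl X≢Y

⊆∧≢⇒∣∣< : {X Y : Subset n} → X ⊆ Y → X ≢ Y → ∣ X ∣ < ∣ Y ∣
⊆∧≢⇒∣∣< {X = []} {[]} _ X≢Y = contradiction refl X≢Y
⊆∧≢⇒∣∣< {X = outside ∷ X} {outside ∷ Y} X⊆Y X≢Y = ⊆∧≢⇒∣∣< (drop-∷-⊆ X⊆Y) (X≢Y ∘ cong (outside ∷_))
⊆∧≢⇒∣∣< {X = outside ∷ X} {inside ∷ Y}  X⊆Y X≢Y = s≤s (p⊆q⇒∣p∣≤∣q∣ (drop-∷-⊆ X⊆Y))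
⊆∧≢⇒∣∣< {X = inside ∷ X}  {y ∷ Y}       X⊆Y X≢Y with X⊆Y here
... | here = s≤s (⊆∧≢⇒∣∣< (drop-∷-⊆ X⊆Y) (X≢Y ∘ cong (inside ∷_)))

_<ˡᶜ_ : Subset n → Subset n → Set
X <ˡᶜ Y = ∣ X ∣ < ∣ Y ∣ ⊎ (∣ X ∣ ≡ ∣ Y ∣ × X ≺ Y)

<ˡᶜ⇒<colex : {X Y : Subset n} → X <ˡᶜ Y → X <colex Y
<ˡᶜ⇒<colex (inj₁ lt)         = inj₁ lt
<ˡᶜ⇒<colex (inj₂ (eq , X≺Y)) = inj₂ (eq , ≺⇒MaxSymDiffIn X≺Y)

<ˡᶜ-asym : {X Y : Subset n} → X <ˡᶜ Y → ¬ Y <ˡᶜ X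
<ˡᶜ-asym (inj₁ x<y)       (inj₁ y<x)       = <-asym x<y y<x
<ˡᶜ-asym (inj₁ x<y)       (inj₂ (eq , _))  = <-irrefl (sym eq) x<y
<ˡᶜ-asym (inj₂ (eq , _))  (inj₁ y<x)       = <-irrefl (sym eq) y<x
<ˡᶜ-asym (inj₂ (_ , X≺Y)) (inj₂ (_ , Y≺X)) = ≺-asym X≺Y Y≺X

-- Levels in colex order and their run lengths

-- The recursion removes the last point, the most significant one in colex, so the list comes out
-- sorted and follows the recursion of `leadingOnes`.
level : ∀ n → ℕ → List (Subset n)
level zero    zero    = [ [] ]
level zero    (suc k) = []
level (suc n) zero    = map (_∷ʳ outside) (level n zero)
level (suc n) (suc k) = map (_∷ʳ outside) (level n (suc k)) ++ map (_∷ʳ inside) (level n k)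

level-size : ∀ n k → All (λ X → ∣ X ∣ ≡ k) (level n k)
level-size zero    zero    = refl ∷ []
level-size zero    (suc k) = []
level-size (suc n) zero    = All.map⁺ (All.map (λ {X} → trans (∣∷ʳ-outside∣ X)) (level-size n zero))
level-size (suc n) (suc k) = All.++⁺
  (All.map⁺ (All.map (λ {X} → trans (∣∷ʳ-outside∣ X)) (level-size n (suc k))))
  (All.map⁺ (All.map (λ {X} eq → trans (∣∷ʳ-inside∣ X) (cong suc eq)) (level-size n k)))

level-sorted : ∀ n k → AllPairs _≺_ (level n k)
level-sorted zero    zero    = [] ∷ []
level-sorted zero    (suc k) = []
level-sorted (suc n) zero    = AllPairs.map⁺ (AllPairs.map (≺-∷ʳ outside) (level-sorted n zero))
level-sorted (suc n) (suc k) = AllPairs.++⁺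
  (AllPairs.map⁺ (AllPairs.map (≺-∷ʳ outside) (level-sorted n (suc k))))
  (AllPairs.map⁺ (AllPairs.map (≺-∷ʳ inside) (level-sorted n k)))
  (All.map⁺ (All.universal (λ X → All.map⁺ (All.universal (∷ʳ-out≺in X) (level n k))) (level n (suc k))))

∈-level : (X : Subset n) → X ∈ level n ∣ X ∣
∈-level {zero} [] = here refl
∈-level {suc n} X with initLast X
... | X′ , outside , refl rewrite ∣∷ʳ-outside∣ X′ with ∣ X′ ∣ | ∈-level X′
...   | zero  | X′∈ = ∈-map⁺ (_∷ʳ outside) X′∈
...   | suc k | X′∈ = ∈-++⁺ˡ (∈-map⁺ (_∷ʳ outside) X′∈)
∈-level {suc n} X | X′ , inside , refl rewrite ∣∷ʳ-inside∣ X′ =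
  ∈-++⁺ʳ (map (_∷ʳ outside) (level n (suc ∣ X′ ∣))) (∈-map⁺ (_∷ʳ inside) (∈-level X′))

level-empty : ∀ n k → n < k → level n k ≡ []
level-empty zero    (suc k) _ = refl
level-empty (suc n) (suc k) (s≤s n<k)
  rewrite level-empty n k n<k | level-empty n (suc k) (m≤n⇒m≤1+n n<k) = refl

-- The sets whose colex-least upper cover is X: those X ∖ {i} for which [i] ⊆ X.
unfill : Subset n → List (Subset n)
unfill []            = []
unfill (outside ∷ X) = []
unfill (inside ∷ X)  = (outside ∷ X) ∷ map (inside ∷_) (unfill X)

initialRun : Subset n → ℕ
initialRun []            = zero
initialRun (outside ∷ X) = zero
initialRun (inside ∷ X)  = suc (initialRun X)

length-unfill : (X : Subset n) → length (unfill X) ≡ initialRun X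
length-unfill []            = refl
length-unfill (outside ∷ X) = refl
length-unfill (inside ∷ X)  = cong suc (trans (length-map (inside ∷_) (unfill X)) (length-unfill X))

length-concatMap-unfill : (Xs : List (Subset n)) → length (concatMap unfill Xs) ≡ sum (map initialRun Xs)
length-concatMap-unfill []       = refl
length-concatMap-unfill (X ∷ Xs) =
  trans (length-++ (unfill X)) (cong₂ _+_ (length-unfill X) (length-concatMap-unfill Xs))

initialRun-∷ʳ-outside : (X : Subset n) → initialRun (X ∷ʳ outside) ≡ initialRun X
initialRun-∷ʳ-outside []            = refl
initialRun-∷ʳ-outside (outside ∷ X) = refl
initialRun-∷ʳ-outside (inside ∷ X)  = cong suc (initialRun-∷ʳ-outside X)

-- The size bound provides a gap in `X` that stops the run before the new last point.
initialRun-∷ʳ-inside : (X : Subset n) → ∣ X ∣ < n → initialRun (X ∷ʳ inside) ≡ initialRun X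
initialRun-∷ʳ-inside []            ()
initialRun-∷ʳ-inside (outside ∷ X) _        = refl
initialRun-∷ʳ-inside (inside ∷ X)  (s≤s lt) = cong suc (initialRun-∷ʳ-inside X lt)

level-full : ∀ n → level n n ≡ [ ⊤ ]
level-full zero = refl
level-full (suc n) rewrite level-empty n (suc n) ≤-refl | level-full n = cong [_] (⊤-∷ʳ n)
  where
  ⊤-∷ʳ : ∀ n → ⊤ {n} ∷ʳ inside ≡ ⊤
  ⊤-∷ʳ zero    = refl
  ⊤-∷ʳ (suc n) = cong (inside ∷_) (⊤-∷ʳ n)

initialRun-⊤ : ∀ n → initialRun (⊤ {n}) ≡ n
initialRun-⊤ zero    = refl
initialRun-⊤ (suc n) = cong suc (initialRun-⊤ n)

map-map-local : ∀ {A B : Set} {f : A → B} {g : B → ℕ} {h : A → ℕ} {xs} →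
  All (λ x → g (f x) ≡ h x) xs → map g (map f xs) ≡ map h xs
map-map-local {xs = xs} eqs = trans (sym (map-∘ xs)) (map-cong-local eqs)

-- Appending a last point preserves the run of every set that is not full. The full set appears only
-- for `l = 0`, which is why `leadingOnes` has its separate value there.
map-initialRun : ∀ n k l → n ≡ k + l → map initialRun (level n k) ≡ leadingOnes k l
map-initialRun zero    zero    l eq = refl
map-initialRun (suc n) zero    l eq =
  trans (map-map-local (All.universal initialRun-∷ʳ-outside (level n zero))) (map-initialRun n zero n refl)
map-initialRun (suc n) (suc k) zero eq
  rewrite trans (suc-injective eq) (+-identityʳ k) | level-full (suc k) = cong [_] (initialRun-⊤ (suc k))
map-initialRun (suc n) (suc k) (suc l) eq = trans
  (map-++ initialRun (map (_∷ʳ outside) (level n (suc k))) (map (_∷ʳ inside) (level n k)))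
  (cong₂ _++_
    (trans (map-map-local (All.universal initialRun-∷ʳ-outside (level n (suc k))))
      (map-initialRun n (suc k) l (trans (suc-injective eq) (+-suc k l))))
    (trans (map-map-local (All.map (λ {X} ∣X∣≡k → initialRun-∷ʳ-inside X (subst (_< n) (sym ∣X∣≡k) k<n)) (level-size n k)))
      (map-initialRun n k (suc l) (suc-injective eq))))
  where
  k<n : k < n
  k<n = subst (k <_) (sym (suc-injective eq)) (m<m+n k (s≤s z≤n))

length-level : ∀ n k l → n ≡ k + l → length (level n k) ≡ length (leadingOnes k l)
length-level n k l eq = trans (sym (length-map initialRun (level n k))) (cong length (map-initialRun n k l eq))

-- The least upper cover of Y in colex order is obtained by adding its least missing point.
unfill-⊂ : (Y Z : Subset n) → Y ⊆ Z → Y ≢ Z → ∃ λ X → Y ∈ unfill X × (X ≡ Z ⊎ X <ˡᶜ Z)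
unfill-⊂ [] [] _ Y≢Z = contradiction refl Y≢Z
unfill-⊂ (inside ∷ Y) (z ∷ Z) Y⊆Z Y≢Z with Y⊆Z here
... | here with unfill-⊂ Y Z (drop-∷-⊆ Y⊆Z) (Y≢Z ∘ cong (inside ∷_))
...   | X , Y∈ , inj₁ refl               = inside ∷ X , there (∈-map⁺ (inside ∷_) Y∈) , inj₁ refl
...   | X , Y∈ , inj₂ (inj₁ lt)          = inside ∷ X , there (∈-map⁺ (inside ∷_) Y∈) , inj₂ (inj₁ (s≤s lt))
...   | X , Y∈ , inj₂ (inj₂ (eq , X≺Z))  = inside ∷ X , there (∈-map⁺ (inside ∷_) Y∈) ,
  inj₂ (inj₂ (cong suc eq , there X≺Z))
-- The cover gains the first point. As `Z` has at least one element more than `Y`, it is either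
-- still larger than the cover or ties with it in size, and then the later points decide in favour
-- of `Z`.
unfill-⊂ (outside ∷ Y) (outside ∷ Z) Y⊆Z Y≢Z = inside ∷ Y , here refl , inj₂ (compare (m≤n⇒m<n∨m≡n ∣Y∣<∣Z∣))
  where
  Y⊆Z′ : Y ⊆ Z
  Y⊆Z′ = drop-∷-⊆ Y⊆Z
  Y≢Z′ : Y ≢ Z
  Y≢Z′ = Y≢Z ∘ cong (outside ∷_)
  ∣Y∣<∣Z∣ : ∣ Y ∣ < ∣ Z ∣
  ∣Y∣<∣Z∣ = ⊆∧≢⇒∣∣< Y⊆Z′ Y≢Z′
  compare : suc ∣ Y ∣ < ∣ Z ∣ ⊎ suc ∣ Y ∣ ≡ ∣ Z ∣ → inside ∷ Y <ˡᶜ outside ∷ Z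
  compare (inj₁ lt) = inj₁ lt
  compare (inj₂ eq) = inj₂ (eq , there (⊆∧≢⇒≺ Y⊆Z′ Y≢Z′))
unfill-⊂ (outside ∷ Y) (inside ∷ Z) Y⊆Z Y≢Z with Y ≟ˢ Z
... | yes refl = inside ∷ Y , here refl , inj₁ refl
... | no Y≢Z′  = inside ∷ Y , here refl , inj₂ (inj₁ (s≤s (⊆∧≢⇒∣∣< (drop-∷-⊆ Y⊆Z) Y≢Z′)))

-- Kruskal–Katona

count : {P : Pred (Subset n) 0ℓ} → Decidable P → ℕ → ℕ
count {n} P? k = length (filter P? (level n k))

count-suc : {P : Pred (Subset (suc n)) 0ℓ} (P? : Decidable P) (k : ℕ) →
  count P? (suc k) ≡ count (P? ∘ (_∷ʳ outside)) (suc k) + count (P? ∘ (_∷ʳ inside)) k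
count-suc {n} P? k = trans
  (length-filter-++ P? (map (_∷ʳ outside) (level n (suc k))) (map (_∷ʳ inside) (level n k)))
  (cong₂ _+_ (length-filter-map P? (_∷ʳ outside) (level n (suc k))) (length-filter-map P? (_∷ʳ inside) (level n k)))

count≤ : ∀ {P : Pred (Subset n) 0ℓ} (P? : Decidable P) k l → n ≡ k + l → count P? k ≤ length (leadingOnes k l)
count≤ {n} P? k l eq = ≤-trans (length-filter P? (level n k)) (≤-reflexive (length-level n k l eq))

ShadowedBy : Pred (Subset n) 0ℓ → Pred (Subset n) 0ℓ → Set
ShadowedBy P Q = ∀ {X Y} → Y ⊆ X → ∣ Y ∣ < ∣ X ∣ → P X → Q Y

shadowedBy-out : {P Q : Pred (Subset (suc n)) 0ℓ} → ShadowedBy P Q → ShadowedBy (P ∘ (_∷ʳ outside)) (Q ∘ (_∷ʳ outside))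
shadowedBy-out sh {X} {Y} Y⊆X lt rewrite sym (∣∷ʳ-outside∣ X) | sym (∣∷ʳ-outside∣ Y) = sh (∷ʳ-⊆ outside Y⊆X) lt

shadowedBy-in : {P Q : Pred (Subset (suc n)) 0ℓ} → ShadowedBy P Q → ShadowedBy (P ∘ (_∷ʳ inside)) (Q ∘ (_∷ʳ inside))
shadowedBy-in sh {X} {Y} Y⊆X lt =
  sh (∷ʳ-⊆ inside Y⊆X) (subst₂ _<_ (sym (∣∷ʳ-inside∣ Y)) (sym (∣∷ʳ-inside∣ X)) (s≤s lt))

-- The prefix sum is the size of the shadow of a colex-initial segment with as many sets. Split by
-- the last point: `Q₀` contains the shadow of `P₀` and a copy of `P₁`, which gives the maximum in
-- `eckhoffWegner`, and `Q₁` contains the shadow of `P₁`.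
kruskalKatona : ∀ n k l → n ≡ suc k + l → {P Q : Pred (Subset n) 0ℓ} (P? : Decidable P) (Q? : Decidable Q) →
  ShadowedBy P Q → prefixSum (leadingOnes (suc k) l) (count P? (suc k)) ≤ count Q? k
kruskalKatona (suc n) k l eq {P} {Q} P? Q? sh rewrite count-suc P? k = by-cases k l eq
  where
  open ≤-Reasoning
  P₀? = P? ∘ (_∷ʳ outside)
  P₁? = P? ∘ (_∷ʳ inside)
  Q₀? = Q? ∘ (_∷ʳ outside)
  Q₁? = Q? ∘ (_∷ʳ inside)

  P₁≤Q₀ : ∀ k → count P₁? k ≤ count Q₀? k
  P₁≤Q₀ k = length-filter-mono P₁? Q₀? (λ {X} → sh (∷ʳ-out⊆in X)
    (≤-reflexive (trans (cong suc (∣∷ʳ-outside∣ X)) (sym (∣∷ʳ-inside∣ X))))) (level n k)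

  zero-P₀ : ∀ k → suc n ≡ suc k + 0 → count P₀? (suc k) ≡ 0
  zero-P₀ k eq = cong (length ∘ filter P₀?)
    (level-empty n (suc k) (≤-reflexive (trans eq (+-identityʳ (suc k)))))

  split-Q₀ : count Q? 0 ≡ count Q₀? 0
  split-Q₀ = length-filter-map Q? (_∷ʳ outside) (level n 0)

  by-cases : ∀ k l → suc n ≡ suc k + l →
    prefixSum (leadingOnes (suc k) l) (count P₀? (suc k) + count P₁? k) ≤ count Q? k
  by-cases zero zero eq rewrite zero-P₀ 0 eq | split-Q₀ with count P₁? 0 | P₁≤Q₀ 0
  ... | zero  | _ = z≤n
  ... | suc m | p rewrite take-[] {A = ℕ} m = ≤-trans (s≤s z≤n) p
  -- Only the full set can occur, with weight `2 + k`: one unit is found in `Q₀`, the other `1 + k`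
  -- in `Q₁` by induction.
  by-cases (suc k) zero eq rewrite zero-P₀ (suc k) eq | count-suc Q? k
    with count P₁? (suc k) | P₁≤Q₀ (suc k) | kruskalKatona n k zero (suc-injective eq) P₁? Q₁? (shadowedBy-in {P = P} {Q} sh)
  ... | zero  | _ | _ = z≤n
  ... | suc m | p | q rewrite take-[] {A = ℕ} m = +-mono-≤ (≤-trans (s≤s z≤n) p) q
  by-cases zero (suc l) eq rewrite split-Q₀ = begin
    prefixSum (leadingOnes 1 (suc l)) (f₀ + f₁)
      ≤⟨ eckhoffWegner zero l f₀ f₁ (count≤ P₀? 1 l eq′) (count≤ P₁? 0 (suc l) (suc-injective eq)) ⟩
    (prefixSum (leadingOnes 1 l) f₀ ⊔ f₁) + prefixSum [ 0 ] f₁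
      ≤⟨ +-mono-≤ (⊔-lub (kruskalKatona n zero l eq′ P₀? Q₀? (shadowedBy-out {P = P} {Q} sh)) (P₁≤Q₀ 0)) (prefixSum≤sum [ 0 ] f₁) ⟩
    count Q₀? 0 + 0
      ≡⟨ +-identityʳ _ ⟩
    count Q₀? 0 ∎
    where
    f₀ = count P₀? 1
    f₁ = count P₁? 0
    eq′ = suc-injective eq
  by-cases (suc k) (suc l) eq rewrite count-suc Q? k = begin
    prefixSum (leadingOnes (2 + k) (suc l)) (f₀ + f₁)
      ≤⟨ eckhoffWegner (suc k) l f₀ f₁ (count≤ P₀? (2 + k) l eq′) (count≤ P₁? (suc k) (suc l) (suc-injective eq)) ⟩
    (prefixSum (leadingOnes (2 + k) l) f₀ ⊔ f₁) + prefixSum (leadingOnes (suc k) (suc l)) f₁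
      ≤⟨ +-mono-≤
           (⊔-lub (kruskalKatona n (suc k) l eq′ P₀? Q₀? (shadowedBy-out {P = P} {Q} sh)) (P₁≤Q₀ (suc k)))
           (kruskalKatona n k (suc l) (suc-injective eq) P₁? Q₁? (shadowedBy-in {P = P} {Q} sh)) ⟩
    count Q₀? (suc k) + count Q₁? k ∎
    where
    f₀ = count P₀? (2 + k)
    f₁ = count P₁? (suc k)
    eq′ = trans (suc-injective eq) (cong suc (+-suc k l))

-- Shadows over all levels

levels : ∀ n → ℕ → ℕ → List (Subset n)
levels n k zero    = level n k
levels n k (suc l) = level n k ++ levels n (suc k) l

-- The run lengths, in level-colex order, of the subsets of `[k + l]` with at least `k` elements.
weights : ℕ → ℕ → List ℕ
weights k zero    = leadingOnes k zero
weights k (suc l) = leadingOnes k (suc l) ++ weights (suc k) l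

map-initialRun-levels : ∀ n k l → n ≡ k + l → map initialRun (levels n k l) ≡ weights k l
map-initialRun-levels n k zero    eq = map-initialRun n k zero eq
map-initialRun-levels n k (suc l) eq = trans (map-++ initialRun (level n k) (levels n (suc k) l))
  (cong₂ _++_ (map-initialRun n k (suc l) eq) (map-initialRun-levels n (suc k) l (trans eq (+-suc k l))))

leadingOnes-▷-weights : ∀ j l d → leadingOnes j (l + d) ▷ weights (j + d) l
leadingOnes-▷-weights j zero    d = leadingOnes-▷ j zero d
leadingOnes-▷-weights j (suc l) d =
  ▷-++ʳ (leadingOnes j (suc l + d)) (leadingOnes (j + d) (suc l)) (weights (suc (j + d)) l)
    (leadingOnes-▷ j (suc l) d)
    (subst₂ _▷_ (cong (leadingOnes j) (+-suc l d)) (cong (λ z → weights z l) (+-suc j d))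
      (leadingOnes-▷-weights j l (suc d)))

leadingOnes-▷-next : ∀ k l → leadingOnes k (suc l) ▷ weights (suc k) l
leadingOnes-▷-next k l = subst₂ _▷_ (cong (leadingOnes k) (+-comm l 1)) (cong (λ z → weights z l) (+-comm k 1))
  (leadingOnes-▷-weights k l 1)

length-filter-levels : ∀ n k l → n ≡ k + l → {P : Pred (Subset n) 0ℓ} (P? : Decidable P) →
  length (filter P? (levels n k l)) ≤ length (weights k l)
length-filter-levels n k l eq P? = ≤-trans (length-filter P? (levels n k l))
  (≤-reflexive (trans (sym (length-map initialRun (levels n k l))) (cong length (map-initialRun-levels n k l eq))))

module _ {P Q : Pred (Subset n) 0ℓ} (P? : Decidable P) (Q? : Decidable Q) (sh : ShadowedBy P Q) where

  open ≤-Reasoning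

  -- The levels are filled from the bottom: the members above level `suc k`, already gathered into a
  -- prefix by induction, are poured into the free places of that level, while Kruskal-Katona
  -- accounts for the level itself.
  weights≤shadow : ∀ k l → n ≡ suc k + l →
    prefixSum (weights (suc k) l) (length (filter P? (levels n (suc k) l))) ≤
    length (filter Q? (levels n k (suc l)))
  weights≤shadow k zero    eq = begin
    prefixSum (leadingOnes (suc k) zero) (count P? (suc k))
      ≤⟨ kruskalKatona n k zero eq P? Q? sh ⟩
    count Q? k
      ≤⟨ m≤m+n (count Q? k) (count Q? (suc k)) ⟩
    count Q? k + count Q? (suc k)
      ≡⟨ sym (length-filter-++ Q? (level n k) (level n (suc k))) ⟩
    length (filter Q? (level n k ++ level n (suc k))) ∎
  weights≤shadow k (suc l) eq = begin
    prefixSum (weights (suc k) (suc l)) (length (filter P? (levels n (suc k) (suc l))))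
      ≡⟨ cong (prefixSum (weights (suc k) (suc l)))
           (length-filter-++ P? (level n (suc k)) (levels n (2 + k) l)) ⟩
    prefixSum (weights (suc k) (suc l)) (a + b)
      ≤⟨ leadingOnes-▷-next (suc k) l a b
           (count≤ P? (suc k) (suc l) eq) (length-filter-levels n (2 + k) l eq′ P?) ⟩
    prefixSum (leadingOnes (suc k) (suc l)) a + prefixSum (weights (2 + k) l) b
      ≤⟨ +-mono-≤ (kruskalKatona n k (suc l) eq P? Q? sh) (weights≤shadow (suc k) l eq′) ⟩
    count Q? k + length (filter Q? (levels n (suc k) (suc l)))
      ≡⟨ sym (length-filter-++ Q? (level n k) (levels n (suc k) (suc l))) ⟩
    length (filter Q? (levels n k (2 + l))) ∎
    where
    a = count P? (suc k)
    b = length (filter P? (levels n (2 + k) l))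
    eq′ = trans eq (cong suc (+-suc k l))

  -- The empty set has run 0, so including level 0 adds no weight, and its free place can be filled
  -- at no cost.
  weights≤shadow-all : ∀ m → n ≡ m →
    prefixSum (weights 0 m) (length (filter P? (levels n 0 m))) ≤ length (filter Q? (levels n 0 m))
  weights≤shadow-all zero    eq = ≤-trans (prefixSum≤sum [ 0 ] (length (filter P? (level n 0)))) z≤n
  weights≤shadow-all (suc m) eq = begin
    prefixSum (weights 0 (suc m)) (length (filter P? (levels n 0 (suc m))))
      ≡⟨ cong (prefixSum (weights 0 (suc m))) (length-filter-++ P? (level n 0) (levels n 1 m)) ⟩
    prefixSum (weights 0 (suc m)) (a + b)
      ≤⟨ 0▷ (weights 1 m) a b (count≤ P? 0 n refl) (length-filter-levels n 1 m eq P?) ⟩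
    prefixSum [ 0 ] a + prefixSum (weights 1 m) b
      ≤⟨ +-mono-≤ (prefixSum≤sum [ 0 ] a) (weights≤shadow 0 m eq) ⟩
    length (filter Q? (levels n 0 (suc m))) ∎
    where
    a = count P? 0
    b = length (filter P? (levels n 1 m))

-- Initial segments of level-colex

levels-size : ∀ n k l → All (λ X → k ≤ ∣ X ∣) (levels n k l)
levels-size n k zero    = All.map (≤-reflexive ∘ sym) (level-size n k)
levels-size n k (suc l) = All.++⁺ (All.map (≤-reflexive ∘ sym) (level-size n k))
  (All.map (≤-trans (n≤1+n k)) (levels-size n (suc k) l))

level-<ˡᶜ-sorted : ∀ n k → AllPairs _<ˡᶜ_ (level n k)
level-<ˡᶜ-sorted n k = combine (level-size n k) (level-sorted n k)
  where
  combine : ∀ {Xs} → All (λ X → ∣ X ∣ ≡ k) Xs → AllPairs _≺_ Xs → AllPairs _<ˡᶜ_ Xs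
  combine []         []         = []
  combine (eq ∷ eqs) (X≺ ∷ srt) =
    All.zipWith (λ (eq′ , X≺Y) → inj₂ (trans eq (sym eq′) , X≺Y)) (eqs , X≺) ∷ combine eqs srt

levels-sorted : ∀ n k l → AllPairs _<ˡᶜ_ (levels n k l)
levels-sorted n k zero    = level-<ˡᶜ-sorted n k
levels-sorted n k (suc l) = AllPairs.++⁺ (level-<ˡᶜ-sorted n k) (levels-sorted n (suc k) l)
  (All.map (λ { {X} refl → All.map inj₁ (levels-size n (suc k) l) }) (level-size n k))

∈-levels : ∀ (X : Subset n) k l → k ≤ ∣ X ∣ → ∣ X ∣ ≤ k + l → X ∈ levels n k l
∈-levels X k zero    k≤ ≤k+l
  rewrite ≤-antisym k≤ (≤-trans ≤k+l (≤-reflexive (+-identityʳ k))) = ∈-level X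
∈-levels {n} X k (suc l) k≤ ≤k+l with m≤n⇒m<n∨m≡n k≤
... | inj₁ k<   = ∈-++⁺ʳ (level n k) (∈-levels X (suc k) l k< (≤-trans ≤k+l (≤-reflexive (+-suc k l))))
... | inj₂ refl = ∈-++⁺ˡ (∈-level X)

levelColex : ∀ n → List (Subset n)
levelColex n = levels n 0 n

∈-levelColex : (X : Subset n) → X ∈ levelColex n
∈-levelColex {n} X = ∈-levels X 0 n z≤n (∣p∣≤n X)

levelColex-unique : ∀ n → Unique (levelColex n)
levelColex-unique n = AllPairs.map (λ { X<Y refl → <ˡᶜ-asym X<Y X<Y }) (levels-sorted n 0 n)

module _ {A : Set} {R : A → A → Set} where

  take-closed : (∀ {x y} → R x y → ¬ R y x) → ∀ {xs x z} m → AllPairs R xs →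
    x ∈ xs → z ∈ take m xs → R x z → x ∈ take m xs
  take-closed asym {_ ∷ _} (suc m) (_ ∷ _)   (here refl) _           _   = here refl
  take-closed asym {_ ∷ _} (suc m) (y< ∷ _)  (there x∈)  (here refl) x<z = contradiction x<z (asym (All.lookup y< x∈))
  take-closed asym {_ ∷ _} (suc m) (_ ∷ srt) (there x∈)  (there z∈)  x<z = there (take-closed asym m srt x∈ z∈ x<z)

  -- Made for a counting argument: a family with nothing at or after `x` must fit into the short
  -- list `ps`.
  take-predecessors : ∀ {xs x} m → AllPairs R xs → x ∈ take m xs →
    ∃ λ ps → length ps < m × (∀ {z} → z ∈ xs → z ∈ ps ⊎ z ≡ x ⊎ R x z)
  take-predecessors {_ ∷ _} (suc m) (x< ∷ _) (here refl) = [] , s≤s z≤n ,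
    λ { (here refl) → inj₂ (inj₁ refl) ; (there z∈) → inj₂ (inj₂ (All.lookup x< z∈)) }
  take-predecessors {y ∷ _} (suc m) (_ ∷ srt) (there x∈) with take-predecessors m srt x∈
  ... | ps , ps<m , cover = y ∷ ps , s≤s ps<m , λ { (here refl) → inj₁ (here refl) ; (there z∈) → there′ (cover z∈) }
    where
    there′ : ∀ {z B} → z ∈ ps ⊎ B → z ∈ y ∷ ps ⊎ B
    there′ (inj₁ z∈) = inj₁ (there z∈)
    there′ (inj₂ b)  = inj₂ b

  unique⇒allPairs : ∀ {xs} → Unique xs → (∀ {x y} → x ∈ xs → y ∈ xs → x ≢ y → R x y) → AllPairs R xs
  unique⇒allPairs []         _ = []
  unique⇒allPairs (x∉ ∷ uxs) r =
    All.tabulate (λ y∈ → r (here refl) (there y∈) (All.lookup x∉ y∈)) ∷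
    unique⇒allPairs uxs (λ x∈ y∈ → r (there x∈) (there y∈))

module _ {n : ℕ} where
  open DecMembership (_≟ˢ_ {n}) using (_∈?_)

  -- If `X` were missing, closure under predecessors would exclude everything after `X` too, leaving
  -- fewer than `m` places for the members of `I`.
  take⊆initial : ∀ {k m} (I : Family n) → IsInitialColex k I → m ≤ size I →
    ∀ {X} → X ∈ take m (levelColex n) → X ∈F I
  take⊆initial {m = m} I (_ , closed) m≤ {X} X∈ with X ∈? members I
  ... | yes X∈I = X∈I
  ... | no  X∉I with take-predecessors m (levels-sorted n 0 n) X∈
  ...   | ps , ps<m , cover = contradiction (length-⊆ (distinct I) I⊆ps) (<⇒≱ (<-≤-trans ps<m m≤))
    where
    I⊆ps : ∀ {Z} → Z ∈F I → Z ∈ ps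
    I⊆ps {Z} Z∈I with cover (∈-levelColex Z)
    ... | inj₁ Z∈ps        = Z∈ps
    ... | inj₂ (inj₁ refl) = contradiction Z∈I X∉I
    ... | inj₂ (inj₂ X<Z)  = contradiction (closed Z X Z∈I (<ˡᶜ⇒<colex X<Z)) X∉I

  -- The maximal members of the first `m` sets: if a member lies properly below another, its
  -- colex-least upper cover comes no later than that one and so is also present.
  tops : ℕ → List (Subset n)
  tops m = filter (λ Y → ¬? (Y ∈? concatMap unfill (take m (levelColex n)))) (take m (levelColex n))

  tops-antichain : ∀ m → AllPairs Incomparable (tops m)
  tops-antichain m = unique⇒allPairs (Unique.filter⁺ _ (Unique.take⁺ m (levelColex-unique n)))
    λ X∈ Y∈ X≢Y → (λ X⊆Y → noncover X∈ Y∈ X⊆Y X≢Y) , (λ Y⊆X → noncover Y∈ X∈ Y⊆X (X≢Y ∘ sym))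
    where
    noncover : ∀ {Y Z} → Y ∈ tops m → Z ∈ tops m → Y ⊆ Z → ¬ Y ≢ Z
    noncover {Y} {Z} Y∈ Z∈ Y⊆Z Y≢Z
      with ∈-filter⁻ _ {xs = take m (levelColex n)} Y∈ | ∈-filter⁻ _ {xs = take m (levelColex n)} Z∈ | unfill-⊂ Y Z Y⊆Z Y≢Z
    ... | _ , Y∉ | Z∈I , _ | X , Y∈X , X≤Z = Y∉ (∈-concatMap⁺ unfill (Any.map (λ { refl → Y∈X }) (X∈I X≤Z)))
      where
      X∈I : X ≡ Z ⊎ X <ˡᶜ Z → X ∈ take m (levelColex n)
      X∈I (inj₁ refl) = Z∈I
      X∈I (inj₂ X<Z)  = take-closed <ˡᶜ-asym m (levels-sorted n 0 n) (∈-levelColex X) Z∈I X<Z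

  -- Every discarded set occurs in some `unfill X` with `X` in the segment, and the lengths of these
  -- lists add up to the prefix sum.
  length-tops : ∀ m → m ≤ length (levelColex n) → m ≤ length (tops m) + prefixSum (weights 0 n) m
  length-tops m m≤ = begin
    m                                 ≡⟨ sym (trans (length-take m (levelColex n)) (m≤n⇒m⊓n≡m m≤)) ⟩
    length J                          ≡⟨ length-filter-∁ (_∈? concatMap unfill J) J ⟩
    length (tops m) + length (filter (_∈? concatMap unfill J) J)
      ≤⟨ +-monoʳ-≤ (length (tops m)) (length-⊆
           (Unique.filter⁺ (_∈? concatMap unfill J) (Unique.take⁺ m (levelColex-unique n)))
           (λ Y∈ → proj₂ (∈-filter⁻ (_∈? concatMap unfill J) {xs = J} Y∈))) ⟩
    length (tops m) + length (concatMap unfill J)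
      ≡⟨ cong (length (tops m) +_) (trans (length-concatMap-unfill J) (cong sum (sym (take-map m (levelColex n))))) ⟩
    length (tops m) + sum (take m (map initialRun (levelColex n)))
      ≡⟨ cong (λ z → length (tops m) + prefixSum z m) (map-initialRun-levels n 0 n refl) ⟩
    length (tops m) + prefixSum (weights 0 n) m ∎
    where
    open ≤-Reasoning
    J = take m (levelColex n)

-- Comparing the antichain with the tops of an initial segment

theorem3 : (n : ℕ) (A I : Family n) → IsDownset A → IsInitialColex (size A) I →
    WidthLE A I
theorem3 n A I downset initial L = M , +-cancelʳ-≤ (length (filter Q? Ω)) _ _ (begin
  length Ls + length (filter Q? Ω) ≡⟨ sym (length-++ Ls) ⟩
  -- The antichain and the proper subsets of its members are disjoint parts of the downset it
  -- generates.
  length (Ls ++ filter Q? Ω)                    ≤⟨ length-⊆ unique-Ls++Q Ls++Q⊆P ⟩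
  N                                                 ≤⟨ length-tops N (length-filter P? Ω) ⟩
  length (tops N) + prefixSum (weights 0 n) N
    ≤⟨ +-monoʳ-≤ (length (tops N)) (weights≤shadow-all P? Q? sh n refl) ⟩
  length (tops N) + length (filter Q? Ω)        ∎)
  where
  open ≤-Reasoning
  Ls = elems L
  Ω = levelColex n

  -- `P` is the downset generated by the antichain, `Q` its non-maximal part.
  P Q : Pred (Subset n) 0ℓ
  P X = Any (X ⊆_) Ls
  Q X = Any (λ Z → X ⊆ Z × ∣ X ∣ < ∣ Z ∣) Ls

  P? : Decidable P
  P? X = any? (X ⊆?_) Ls

  Q? : Decidable Q
  Q? X = any? (λ Z → (X ⊆? Z) ×-dec (∣ X ∣ <? ∣ Z ∣)) Ls

  N = length (filter P? Ω)

  sh : ShadowedBy P Q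
  sh {X} {Y} Y⊆X ∣Y∣<∣X∣ = Any.map {P = X ⊆_} {Q = λ Z → Y ⊆ Z × ∣ Y ∣ < ∣ Z ∣} λ X⊆Z →
    ⊆-trans Y⊆X X⊆Z , <-≤-trans ∣Y∣<∣X∣ (p⊆q⇒∣p∣≤∣q∣ X⊆Z)

  unique-Ls++Q : Unique (Ls ++ filter Q? Ω)
  unique-Ls++Q = Unique.++⁺ (elemsDistinct L) (Unique.filter⁺ Q? (levelColex-unique n)) disjoint
    where
    disjoint : ∀ {X} → ¬ (X ∈ Ls × X ∈ filter Q? Ω)
    disjoint {X} (X∈L , X∈Q) with find (proj₂ (∈-filter⁻ Q? {xs = Ω} X∈Q))
    ... | Z , Z∈L , X⊆Z , lt with ∈-AllPairs₂ (pairwiseIncomparable L) X∈L Z∈L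
    ...   | inj₁ refl             = <-irrefl refl lt
    ...   | inj₂ (inj₁ (X⊈Z , _)) = X⊈Z X⊆Z
    ...   | inj₂ (inj₂ (_ , X⊈Z)) = X⊈Z X⊆Z

  Ls++Q⊆P : ∀ {X} → X ∈ Ls ++ filter Q? Ω → X ∈ filter P? Ω
  Ls++Q⊆P {X} X∈ with ∈-++⁻ Ls X∈
  ... | inj₁ X∈L = ∈-filter⁺ P? (∈-levelColex X) (Any.map ⊆-reflexive X∈L)
  ... | inj₂ X∈Q = ∈-filter⁺ P? (∈-levelColex X) (Any.map proj₁ (proj₂ (∈-filter⁻ Q? {xs = Ω} X∈Q)))

  P⊆A : ∀ {X} → X ∈ filter P? Ω → X ∈F A
  P⊆A {X} X∈ with find (proj₂ (∈-filter⁻ P? {xs = Ω} X∈))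
  ... | Z , Z∈L , X⊆Z = downset Z X (All.lookup (elemsInF L) Z∈L) X⊆Z

  -- The generated downset lies inside `A`, so the first `N` sets of level-colex, and with them
  -- their tops, lie inside `I`.
  N≤I : N ≤ size I
  N≤I = ≤-trans (length-⊆ (Unique.filter⁺ P? (levelColex-unique n)) P⊆A) (≤-reflexive (sym (proj₁ initial)))

  M : AntichainIn I
  M = record
    { elems = tops N
    ; elemsDistinct = Unique.filter⁺ _ (Unique.take⁺ N (levelColex-unique n))
    ; elemsInF = All.tabulate λ X∈ →
        take⊆initial I initial N≤I (proj₁ (∈-filter⁻ _ {xs = take N Ω} X∈))
    ; pairwiseIncomparable = tops-antichain N
    }
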